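{- For any integer $k \geq 2$, every $2k$-connected line graph $L(G)$ has $k$ completely independent spanning trees if $G$ is not super edge-connected or $\delta(G) \geq 2k$.
   Context: All graphs are finite, simple and undirected. $L(G)$ is the line graph of $G$ (vertex set $E(G)$, two vertices adjacent iff the corresponding edges share an endpoint). $\delta(G)$ is the minimum degree of $G$. A graph is $k$-connected if its (vertex) connectivity is at least $k$. An edge-cut of a connected graph is a set of edges whose removal disconnects it; a connected graph is super edge-connected if every minimum edge-cut isolates a vertex. Spanning trees $T_1,\dots,T_k$ of a graph $H$ are completely independent if for any two distinct vertices $u,v$ of $H$, the $u$–$v$ paths in $T_1,\dots,T_k$ are pairwise edge-disjoint and pairwise share no vertex other than $u$ and $v$. -}

module Defs where

open import Data.Nat using (ℕ; suc; _<_; _≤_)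
open import Data.Bool using (Bool; true; false; T)
open import Data.Fin using (Fin) renaming (_<_ to _<ᶠ_)
open import Data.List using (List; []; _∷_; length; filter; allFin)
open import Data.List.Membership.Propositional using (_∈_; _∉_)
open import Data.List.Relation.Unary.All using (All)
open import Data.List.Relation.Unary.Unique.Propositional using (Unique)
open import Data.Product using (Σ; ∃; ∃-syntax; _×_; _,_; proj₁; proj₂)
open import Data.Sum using (_⊎_)
open import Data.Empty using (⊥)
open import Relation.Nullary using (¬_)
open import Relation.Nullary.Decidable using (T?)
open import Relation.Binary.PropositionalEquality using (_≡_; _≢_; refl; sym)

record Graph (V : Set) : Set₁ where
  field
    Adj    : V → V → Set
    Adj-sym    : ∀ {u v} → Adj u v → Adj v u
    Adj-irrefl : ∀ {v} → ¬ Adj v v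
open Graph public

data Walk {V : Set} (R : V → V → Set) : V → V → List V → Set where
  nil  : ∀ v → Walk R v v (v ∷ [])
  cons : ∀ {u w v vs} → R u w → Walk R w v vs → Walk R u v (u ∷ vs)

SimplePath : {V : Set} → (V → V → Set) → V → V → List V → Set
SimplePath R u v vs = Walk R u v vs × Unique vs

ConnectedRel : {V : Set} → (V → V → Set) → Set
ConnectedRel {V} R = ∀ (u v : V) → ∃[ vs ] Walk R u v vs

Cycle : {V : Set} → (V → V → Set) → Set
Cycle {V} R = Σ V λ u → Σ V λ v → Σ (List V) λ vs →
  Walk R u v vs × Unique vs × 3 ≤ length vs × R v u

record IsSpanningTree {V : Set} (H : Graph V) (T : V → V → Set) : Set where
  field
    sub       : ∀ {u v} → T u v → Adj H u v
    symmetric : ∀ {u v} → T u v → T v u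
    connected : ConnectedRel T
    acyclic   : ¬ Cycle T

data Consec {V : Set} (a b : V) : List V → Set where
  here  : ∀ {xs} → Consec a b (a ∷ b ∷ xs)
  there : ∀ {x xs} → Consec a b xs → Consec a b (x ∷ xs)

EdgeOn : {V : Set} → V → V → List V → Set
EdgeOn a b xs = Consec a b xs ⊎ Consec b a xs

EdgeDisjoint : {V : Set} → List V → List V → Set
EdgeDisjoint {V} P Q = ∀ (a b : V) → EdgeOn a b P → EdgeOn a b Q → ⊥

InternallyDisjoint : {V : Set} → V → V → List V → List V → Set
InternallyDisjoint {V} u v P Q = ∀ (x : V) → x ∈ P → x ∈ Q → x ≡ u ⊎ x ≡ v

HasCISTs : {V : Set} → Graph V → ℕ → Set₁
HasCISTs {V} H k =
  Σ (Fin k → V → V → Set) λ Ts →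
    (∀ i → IsSpanningTree H (Ts i)) ×
    (∀ (i j : Fin k) → i ≢ j → ∀ (u v : V) → u ≢ v →
       ∀ P Q → SimplePath (Ts i) u v P → SimplePath (Ts j) u v Q →
       EdgeDisjoint P Q × InternallyDisjoint u v P Q)

KConnected : {V : Set} → Graph V → ℕ → Set
KConnected {V} H k =
  (Σ (List V) λ xs → length xs ≡ suc k × Unique xs) ×
  (∀ (S : List V) → length S < k → ∀ (u v : V) → u ∉ S → v ∉ S →
     ∃[ vs ] (Walk (Adj H) u v vs × All (_∉ S) vs))

record FinGraph (n : ℕ) : Set where
  field
    adj     : Fin n → Fin n → Bool
    adjSym  : ∀ i j → adj i j ≡ adj j i
    adjIrr  : ∀ i → adj i i ≡ false
open FinGraph public

toGraph : ∀ {n} → FinGraph n → Graph (Fin n)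
toGraph G = record
  { Adj = λ i j → T (adj G i j)
  ; Adj-sym = λ {i} {j} a → subst-T (adjSym G i j) a
  ; Adj-irrefl = λ {i} a → absurd (adjIrr G i) a
  }
  where
  subst-T : ∀ {x y : Bool} → x ≡ y → T x → T y
  subst-T refl t = t
  absurd : ∀ {x : Bool} → x ≡ false → T x → ⊥
  absurd refl ()

Edge : ∀ {n} → FinGraph n → Set
Edge {n} G = Σ (Fin n × Fin n) λ p → proj₁ p <ᶠ proj₂ p × T (adj G (proj₁ p) (proj₂ p))

ends : ∀ {n} {G : FinGraph n} → Edge G → Fin n × Fin n
ends e = proj₁ e

ShareEnd : ∀ {n} {G : FinGraph n} → Edge G → Edge G → Set
ShareEnd {G = G} e f =
  let (a , b) = ends {G = G} e ; (c , d) = ends {G = G} f in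
  (a ≡ c ⊎ a ≡ d) ⊎ (b ≡ c ⊎ b ≡ d)

LineGraph : ∀ {n} → (G : FinGraph n) → Graph (Edge G)
LineGraph {n} G = record
  { Adj = λ e f → ends {G = G} e ≢ ends {G = G} f × ShareEnd {G = G} e f
  ; Adj-sym = λ { (ne , s) → (λ eq → ne (sym eq)) , swap s }
  ; Adj-irrefl = λ { (ne , _) → ne refl }
  }
  where
  open import Data.Sum using (inj₁; inj₂)
  swap : ∀ {a b c d : Fin n} → (a ≡ c ⊎ a ≡ d) ⊎ (b ≡ c ⊎ b ≡ d)
                              → (c ≡ a ⊎ c ≡ b) ⊎ (d ≡ a ⊎ d ≡ b)
  swap (inj₁ (inj₁ p)) = inj₁ (inj₁ (sym p))
  swap (inj₁ (inj₂ p)) = inj₂ (inj₁ (sym p))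
  swap (inj₂ (inj₁ p)) = inj₁ (inj₂ (sym p))
  swap (inj₂ (inj₂ p)) = inj₂ (inj₂ (sym p))

degree : ∀ {n} → FinGraph n → Fin n → ℕ
degree {n} G v = length (filter (λ j → T? (adj G v j)) (allFin n))

MinDegreeAtLeast : ∀ {n} → FinGraph n → ℕ → Set
MinDegreeAtLeast {n} G d = ∀ (v : Fin n) → d ≤ degree G v

IsEdgeSet : ∀ {n} → FinGraph n → List (Fin n × Fin n) → Set
IsEdgeSet G F = Unique F × All (λ p → proj₁ p <ᶠ proj₂ p × T (adj G (proj₁ p) (proj₂ p))) F

DeleteEdges : ∀ {n} → FinGraph n → List (Fin n × Fin n) → Fin n → Fin n → Set
DeleteEdges G F u v = T (adj G u v) × (u , v) ∉ F × (v , u) ∉ F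

IsEdgeCut : ∀ {n} → FinGraph n → List (Fin n × Fin n) → Set
IsEdgeCut G F = IsEdgeSet G F × ¬ ConnectedRel (DeleteEdges G F)

IsMinEdgeCut : ∀ {n} → FinGraph n → List (Fin n × Fin n) → Set
IsMinEdgeCut G F = IsEdgeCut G F × (∀ F' → IsEdgeCut G F' → length F ≤ length F')

IsolatesVertex : ∀ {n} → FinGraph n → List (Fin n × Fin n) → Set
IsolatesVertex {n} G F =
  ∃[ v ] ∀ (w : Fin n) → T (adj G v w) → (v , w) ∈ F ⊎ (w , v) ∈ F

SuperEdgeConnected : ∀ {n} → FinGraph n → Set
SuperEdgeConnected G =
  ConnectedRel (Adj (toGraph G)) ×
  (∀ F → IsMinEdgeCut G F → IsolatesVertex G F)

{-# OPTIONS --safe #-}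

-- Deleting fewer than 2k edges of G cannot separate two edges of G, because
-- L(G) is 2k-connected; so a cut with fewer than 2k edges must isolate a vertex,
-- and either hypothesis excludes this.  Hence G is 2k-edge-connected, and it
-- decomposes into k connected spanning subgraphs (Nash-Williams, Tutte): take a
-- k-colouring of the edges whose colour classes have as few components as
-- possible, and call an edge free if it becomes redundant in its colour class
-- after some sequence of recolourings of redundant edges.  By extremality the
-- ends of a free edge are joined by free edges of every colour; a degree count
-- yields a free edge; contract the free edges and induct.
--
-- Root a spanning tree Tᵢ of each colour class at a common vertex r.  The i-th
-- tree of L(G) consists of the edges of Tᵢ, with every other edge of G hung as a
-- leaf on the Tᵢ-edge above one of its ends: for an edge of Tⱼ, its upper end,
-- or its lower end if the upper one is r.  With this choice no two edges hang on
-- each other, so the trees are edge-disjoint, and only the edges of Tᵢ are inner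
-- vertices of the i-th tree.
module Submission where

open import Defs
open import Data.Bool using (Bool; true; false; T; if_then_else_)
import Data.Bool.Properties as Bool
open import Data.Empty using (⊥; ⊥-elim)
open import Data.Fin using (Fin; zero; suc; punchIn; punchOut; remQuot; combine)
import Data.Fin as Fin
open import Data.Fin.Properties using (_≟_; any?; all?; <-cmp; punchOut-cong; punchOut-injective; punchOut-punchIn; punchInᵢ≢i; injective⇒≤; ¬∀⟶∃¬; remQuot-combine; combine-remQuot)
open import Data.List using (List; []; _∷_; length; map; filter; lookup; tabulate; allFin)
open import Data.List.Properties using (length-map)
open import Data.List.Membership.DecPropositional using () renaming (_∈?_ to ∈-dec)
open import Data.List.Membership.Propositional using (_∈_; _∉_)
open import Data.List.Membership.Propositional.Properties using (∈-map⁺; ∈-map⁻; ∈-filter⁺; ∈-filter⁻; ∈-allFin; ∈-lookup)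
open import Data.List.Relation.Unary.All using (All; []; _∷_)
import Data.List.Relation.Unary.All as All
open import Data.List.Relation.Unary.All.Properties using (¬Any⇒All¬; All¬⇒¬Any)
open import Data.List.Relation.Unary.AllPairs using ([]; _∷_)
open import Data.List.Relation.Unary.Any using (here; there; index)
open import Data.List.Relation.Unary.Any.Properties using (lookup-index)
open import Data.List.Relation.Unary.Unique.Propositional using (Unique)
open import Data.List.Relation.Unary.Unique.Propositional.Properties using (map⁺; filter⁺; allFin⁺)
open import Data.Nat using (ℕ; zero; suc; _+_; _*_; _≤_; _<_; z≤n; s≤s; s≤s⁻¹)
open import Data.Nat.Induction using (<-rec)
open import Data.Nat.Properties using (+-*-semiring; +-mono-≤; +-mono-<-≤; +-mono-≤-<; +-suc; +-identityʳ; *-assoc; *-comm; *-monoʳ-<; m≤m+n; m≤n+m; n≤1+n; n<1+n; ≤-refl; ≤-reflexive; ≤-trans; ≤-<-trans; <-trans; <⇒≤; <⇒≱; ≤⇒≯; ≰⇒>; <-irrefl; <-asym; <-irrelevant; _≤?_; module ≤-Reasoning)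
open import Data.Product using (∃; ∃₂; _×_; _,_; proj₁; proj₂; uncurry)
import Data.Product.Properties as Product
open import Data.Sum using (_⊎_; inj₁; inj₂; [_,_]′; swap)
open import Data.Vec using (Vec; []; _∷_)
import Data.Vec as Vec
open import Data.Vec.Properties using (lookup∘tabulate)
open import Function using (_∘_; id; const; Injective)
open import Relation.Binary.Construct.Closure.ReflexiveTransitive using (Star; ε; _◅_; _◅◅_; reverse; kleisliStar)
import Relation.Binary.Construct.Closure.ReflexiveTransitive as Star
open import Relation.Binary.Definitions using (DecidableEquality; tri<; tri≈; tri>)
open import Relation.Binary.PropositionalEquality using (_≡_; _≢_; refl; sym; trans; cong; cong₂; subst; subst₂)
open import Relation.Nullary using (¬_; Dec; yes; no; does; ¬?; _×-dec_; _⊎-dec_; contradiction)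
open import Relation.Nullary.Decidable using (T?; map′; ¬¬-excluded-middle)
open import Relation.Unary using (Pred; Decidable)

open import Algebra.Properties.Semiring.Sum +-*-semiring using (sum; ∑-comm; ∑-distrib-+)

private variable
  A B V : Set
  n q : ℕ

-- Indicators, finite sums and counting in lists.

ind : Dec A → ℕ
ind a? = if does a? then 1 else 0

ind-mono : (A → B) → (a? : Dec A) (b? : Dec B) → ind a? ≤ ind b?
ind-mono f (no _)  b?       = z≤n
ind-mono f (yes a) (yes _)  = ≤-refl
ind-mono f (yes a) (no ¬b)  = ⊥-elim (¬b (f a))

ind-strict : ¬ A → B → (a? : Dec A) (b? : Dec B) → ind a? < ind b?
ind-strict ¬a b (yes a) _       = ⊥-elim (¬a a)
ind-strict ¬a b (no _)  (no ¬b) = ⊥-elim (¬b b)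
ind-strict ¬a b (no _)  (yes _) = ≤-refl

sum-mono : {f g : Fin n → ℕ} → (∀ i → f i ≤ g i) → sum f ≤ sum g
sum-mono {zero}  f≤g = z≤n
sum-mono {suc n} f≤g = +-mono-≤ (f≤g zero) (sum-mono (f≤g ∘ suc))

sum-strict : {f g : Fin n → ℕ} → (∀ i → f i ≤ g i) → ∀ i → f i < g i → sum f < sum g
sum-strict f≤g zero    f<g = +-mono-<-≤ f<g (sum-mono (f≤g ∘ suc))
sum-strict f≤g (suc i) f<g = +-mono-≤-< (f≤g zero) (sum-strict (f≤g ∘ suc) i f<g)

ind-no : ¬ A → (a? : Dec A) → ind a? ≡ 0
ind-no ¬a (yes a) = ⊥-elim (¬a a)
ind-no ¬a (no _)  = refl

sum-≤ : ∀ {n d} {f : Fin n → ℕ} → (∀ i → f i ≤ d) → sum f ≤ n * d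
sum-≤ {zero}  f≤d = z≤n
sum-≤ {suc n} f≤d = +-mono-≤ (f≤d zero) (sum-≤ (f≤d ∘ suc))

sum-≥ : ∀ {n d} {f : Fin n → ℕ} → (∀ i → d ≤ f i) → n * d ≤ sum f
sum-≥ {zero}  d≤f = z≤n
sum-≥ {suc n} d≤f = +-mono-≤ (d≤f zero) (sum-≥ (d≤f ∘ suc))

term≤sum : ∀ {n} (f : Fin n → ℕ) i → f i ≤ sum f
term≤sum f zero    = m≤m+n _ _
term≤sum f (suc i) = ≤-trans (term≤sum (f ∘ suc) i) (m≤n+m _ _)

sum-ind-≟ : ∀ {n} (a : Fin n) → sum (λ i → ind (i ≟ a)) ≤ 1
sum-ind-≟ {suc n} zero    = s≤s (≤-trans (sum-≤ {n} {0} {λ i → ind (suc i ≟ zero)} (λ _ → z≤n))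
  (≤-reflexive (*-comm n 0)))
sum-ind-≟ {suc n} (suc a) = sum-ind-≟ a

length-filter-tabulate : {P : Pred A _} (P? : Decidable P) (f : Fin n → A) →
  length (filter P? (tabulate f)) ≡ sum (λ i → ind (P? (f i)))
length-filter-tabulate {n = zero}  P? f = refl
length-filter-tabulate {n = suc n} P? f with does (P? (f zero))
... | true  = cong suc (length-filter-tabulate P? (f ∘ suc))
... | false = length-filter-tabulate P? (f ∘ suc)

lookup-injective : ∀ {A : Set} {xs : List A} → Unique xs → ∀ {i j} → lookup xs i ≡ lookup xs j → i ≡ j
lookup-injective (_ ∷ _) {zero} {zero} _ = refl
lookup-injective (x∉ ∷ _) {zero} {suc j} eq = ⊥-elim (All.lookup x∉ (∈-lookup j) eq)
lookup-injective (x∉ ∷ _) {suc i} {zero} eq = ⊥-elim (All.lookup x∉ (∈-lookup i) (sym eq))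
lookup-injective (_ ∷ distinct) {suc i} {suc j} eq = cong suc (lookup-injective distinct eq)

unique-⊆-length : ∀ {A : Set} {xs ys : List A} → Unique xs → (∀ {x} → x ∈ xs → x ∈ ys) → length xs ≤ length ys
unique-⊆-length {xs = xs} {ys} distinct sub = injective⇒≤ {f = λ i → index (sub (∈-lookup {xs = xs} i))}
  λ {i} {j} eq → lookup-injective distinct (trans (lookup-index (sub (∈-lookup i)))
    (trans (cong (lookup ys) eq) (sym (lookup-index (sub (∈-lookup j))))))

-- Excluded middle for finitely many propositions at once, available when the goal is a
-- contradiction; it lets `Free` be treated as decidable.
¬¬-decide-all : ∀ {m} (P : Fin m → Set) → ¬ ¬ (∀ i → Dec (P i))
¬¬-decide-all {zero}  P ¬all = ¬all λ ()
¬¬-decide-all {suc m} P ¬all =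
  ¬¬-excluded-middle λ p₀ → ¬¬-decide-all (P ∘ suc) λ ps → ¬all λ { zero → p₀ ; (suc i) → ps i }

any-vec? : ∀ {k} m {P : Vec (Fin k) m → Set} → Decidable P → Dec (∃ P)
any-vec? zero    P? = map′ ([] ,_) (λ { ([] , p) → p }) (P? [])
any-vec? (suc m) P? = map′ (λ (i , v , p) → i ∷ v , p) (λ { (i ∷ v , p) → i , v , p })
  (any? λ i → any-vec? m (P? ∘ (i ∷_)))

-- Walks and simple paths

head∈ : ∀ {R : V → V → Set} {u v vs} → Walk R u v vs → u ∈ vs
head∈ (nil _)    = here refl
head∈ (cons _ _) = here refl

star⇒walk : ∀ {R : V → V → Set} {u v} → Star R u v → ∃ (Walk R u v)
star⇒walk ε       = _ , nil _
star⇒walk (r ◅ p) = _ , cons r (proj₂ (star⇒walk p))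

drop-until : ∀ {R : V → V → Set} {u v x vs} → SimplePath R u v vs → x ∈ vs → ∃ (SimplePath R x v)
drop-until p@(nil _ , _)            (here refl) = _ , p
drop-until p@(cons _ _ , _)         (here refl) = _ , p
drop-until (cons _ w , _ ∷ distinct) (there x∈)  = drop-until (w , distinct) x∈

simple-path : ∀ {R : Fin n → Fin n → Set} {u v} → Star R u v → ∃ (SimplePath R u v)
simple-path ε = _ , nil _ , [] ∷ []
simple-path {u = u} (r ◅ p) with simple-path p
... | vs , w , distinct with ∈-dec _≟_ u vs
...   | yes u∈ = drop-until (w , distinct) u∈
...   | no  u∉ = _ , cons r w , ¬Any⇒All¬ vs u∉ ∷ distinct

-- Identifying two elements of a finite set

merge : {a b : Fin (suc q)} → a ≢ b → Fin (suc q) → Fin q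
merge {a = a} a≢b x with a ≟ x
... | yes _  = punchOut a≢b
... | no a≢x = punchOut a≢x

merge-identifies : {a b : Fin (suc q)} (a≢b : a ≢ b) → merge a≢b a ≡ merge a≢b b
merge-identifies {a = a} {b} a≢b with a ≟ a | a ≟ b
... | yes _  | yes a≡b = ⊥-elim (a≢b a≡b)
... | yes _  | no _    = punchOut-cong a refl
... | no a≢a | _       = ⊥-elim (a≢a refl)

merge-kernel : {a b : Fin (suc q)} (a≢b : a ≢ b) (x y : Fin (suc q)) →
  merge a≢b x ≡ merge a≢b y → x ≡ y ⊎ (x ≡ a × y ≡ b ⊎ x ≡ b × y ≡ a)
merge-kernel {a = a} a≢b x y eq with a ≟ x | a ≟ y
... | yes a≡x | yes a≡y = inj₁ (trans (sym a≡x) a≡y)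
... | yes a≡x | no a≢y  = inj₂ (inj₁ (sym a≡x , sym (punchOut-injective a≢b a≢y eq)))
... | no a≢x  | yes a≡y = inj₂ (inj₂ (punchOut-injective a≢x a≢b eq , sym a≡y))
... | no a≢x  | no a≢y  = inj₁ (punchOut-injective a≢x a≢y eq)

merge-punchIn : {a b : Fin (suc q)} (a≢b : a ≢ b) (z : Fin q) → merge a≢b (punchIn a z) ≡ z
merge-punchIn {a = a} a≢b z with a ≟ punchIn a z
... | yes a≡ = ⊥-elim (punchInᵢ≢i a z (sym a≡))
... | no a≢  = trans (punchOut-cong a refl) (punchOut-punchIn a)

-- Connectivity in multigraphs.

module Multigraph {m n : ℕ} (s t : Fin m → Fin n) where

  Joins : Fin m → Fin n → Fin n → Set
  Joins e x y = (s e ≡ x × t e ≡ y) ⊎ (s e ≡ y × t e ≡ x)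

  joins-sym : ∀ {e x y} → Joins e x y → Joins e y x
  joins-sym = [ inj₂ , inj₁ ]′

  Link : (Fin m → Set) → Fin n → Fin n → Set
  Link P x y = ∃ λ e → P e × Joins e x y

  Conn : (Fin m → Set) → Fin n → Fin n → Set
  Conn P = Star (Link P)

  private variable
    P Q : Fin m → Set
    x y : Fin n

  conn-map : (∀ {e} → P e → Q e) → Conn P x y → Conn Q x y
  conn-map f = Star.map λ (e , p , j) → e , f p , j

  conn-sym : Conn P x y → Conn P y x
  conn-sym = reverse λ (e , p , j) → e , p , joins-sym j

  along : ∀ {e} → Joins e x y → Conn P (s e) (t e) → Conn P x y
  along (inj₁ (refl , refl)) p = p
  along (inj₂ (refl , refl)) p = conn-sym p

  against : ∀ {e} → Joins e x y → Conn P x y → Conn P (s e) (t e)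
  against (inj₁ (refl , refl)) p = p
  against (inj₂ (refl , refl)) p = conn-sym p

  across : ∀ {e} → P e → Conn P (s e) (t e)
  across {e = e} p = (e , p , inj₁ (refl , refl)) ◅ ε

  replace : (∀ {e} → P e → Conn Q (s e) (t e)) → Conn P x y → Conn Q x y
  replace f = kleisliStar (λ v → v) λ (e , p , j) → along j (f p)

  -- A further edge joining `x` and `y` would close a cycle through `f`.
  Bypassed : (Fin m → Set) → Fin n → Fin n → Fin m → Set
  Bypassed P x y f = ∃₂ λ u w → Joins f u w ×
    Conn (λ g → P g × g ≢ f) x u × Conn (λ g → P g × g ≢ f) w y

  End : Fin m → Fin n → Set
  End e z = s e ≡ z ⊎ t e ≡ z

  joins-end : ∀ {e z} → Joins e x y → End e z → z ≡ x ⊎ z ≡ y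
  joins-end (inj₁ (a , b)) (inj₁ c) = inj₁ (trans (sym c) a)
  joins-end (inj₁ (a , b)) (inj₂ c) = inj₂ (trans (sym c) b)
  joins-end (inj₂ (a , b)) (inj₁ c) = inj₂ (trans (sym c) a)
  joins-end (inj₂ (a , b)) (inj₂ c) = inj₁ (trans (sym c) b)

  end-joins : ∀ {e} → Joins e x y → End e x
  end-joins (inj₁ (a , b)) = inj₁ a
  end-joins (inj₂ (a , b)) = inj₂ b

  walk-inside : ∀ {vs} → Walk (Link P) x y vs → Conn (λ g → P g × (∀ z → End g z → z ∈ vs)) x y
  walk-inside (nil _) = ε
  walk-inside (cons (f , p , j) w) =
    (f , (p , λ _ e → [ (λ { refl → here refl }) , (λ { refl → there (head∈ w) }) ]′ (joins-end j e)) , j)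
    ◅ conn-map (λ (p , inside) → p , λ z → there ∘ inside z) (walk-inside w)

  -- On a simple path each edge occurs once, so the pieces before and after it avoid it.
  bypass : Conn P x y → Conn (λ f → P f × Bypassed P x y f) x y
  bypass {P} {x} {y} p with simple-path p
  ... | _ , walk , distinct = go ε walk distinct
    where
    -- An edge u–w of the path differs from the earlier edges, which have an
    -- end off the rest of the path, and from the later ones, which avoid u.
    go : ∀ {u vs} → Conn (λ g → P g × ∃ λ z → End g z × z ∉ vs) x u →
         Walk (Link P) u y vs → Unique vs → Conn (λ f → P f × Bypassed P x y f) u y
    go before (nil _) _ = ε
    go {u} before (cons {w = w} {vs = vs} (f , p , j) walk) (u∉ ∷ distinct) =
      (f , (p , u , w , j , conn-map earlier before , conn-map later (walk-inside walk)) , j)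
      ◅ go (conn-map (λ (p , z , e , z∉) → p , z , e , z∉ ∘ there) before
            ◅◅ ((f , (p , u , end-joins j , All¬⇒¬Any u∉) , j) ◅ ε)) walk distinct
      where
      earlier : ∀ {g} → P g × (∃ λ z → End g z × z ∉ u ∷ vs) → P g × g ≢ f
      earlier (p , z , e , z∉) = p , λ { refl → z∉
        ([ (λ { refl → here refl }) , (λ { refl → there (head∈ walk) }) ]′ (joins-end j e)) }
      later : ∀ {g} → P g × (∀ z → End g z → z ∈ vs) → P g × g ≢ f
      later (p , inside) = p , λ { refl → All¬⇒¬Any u∉ (inside _ (end-joins j)) }

  -- Components, with the edge bound for forests.

  record Components (L : List (Fin m)) : Set where
    field
      #comp    : ℕ
      comp     : Fin n → Fin #comp
      rep      : Fin #comp → Fin n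
      comp-rep : ∀ c → comp (rep c) ≡ c
      sound    : ∀ {x y} → comp x ≡ comp y → Conn (_∈ L) x y
      complete : ∀ {e} → e ∈ L → comp (s e) ≡ comp (t e)
      fewer    : #comp < n ⊎ Injective _≡_ _≡_ comp
      forest   : length L + #comp ≤ n ⊎ (∃ λ e → e ∈ L × Conn (λ g → g ∈ L × g ≢ e) (s e) (t e))

  -- Edges are inserted one at a time. An edge inside a class closes a cycle; an edge between two
  -- classes merges them, so `length L + #comp` stays the same until a cycle appears.
  components : (L : List (Fin m)) → Unique L → Components L
  components [] _ = record
    { #comp = n ; comp = λ x → x ; rep = λ x → x ; comp-rep = λ _ → refl
    ; sound = λ { refl → ε } ; complete = λ () ; fewer = inj₂ (λ eq → eq) ; forest = inj₁ ≤-refl }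
  components (e ∷ L) (e∉L ∷ distinct) = extend (components L distinct)
    where
    extend : Components L → Components (e ∷ L)
    extend record { #comp = zero ; comp = φ } with () ← φ (s e)
    extend record { #comp = suc q ; comp = φ ; rep = σ ; comp-rep = φσ ; sound = φ-sound
                  ; complete = φ-complete ; fewer = φ-fewer ; forest = φ-forest } with φ (s e) ≟ φ (t e)
    ... | yes eq = record
      { comp = φ ; rep = σ ; comp-rep = φσ ; sound = conn-map there ∘ φ-sound
      ; complete = λ { (here refl) → eq ; (there f∈) → φ-complete f∈ } ; fewer = φ-fewer
      ; forest = inj₂ (e , here refl ,
          conn-map (λ g∈ → there g∈ , λ { refl → All¬⇒¬Any e∉L g∈ }) (φ-sound eq)) }
    ... | no neq = record
      { comp = merge neq ∘ φ ; rep = σ ∘ punchIn (φ (s e))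
      ; comp-rep = λ c → trans (cong (merge neq) (φσ _)) (merge-punchIn neq c)
      ; sound = λ {x} {y} eq → glue (merge-kernel neq (φ x) (φ y) eq)
      ; complete = λ { (here refl) → merge-identifies neq ; (there f∈) → cong (merge neq) (φ-complete f∈) }
      ; fewer = inj₁ (smaller φ-fewer)
      ; forest = [ (λ le → inj₁ (≤-trans (≤-reflexive (sym (+-suc (length L) q))) le))
                 , (λ (f , f∈ , p) → inj₂ (f , there f∈ , conn-map (λ (g∈ , g≢) → there g∈ , g≢) p)) ]′ φ-forest }
      where
      φ-conn : ∀ {x y} → φ x ≡ φ y → Conn (_∈ e ∷ L) x y
      φ-conn = conn-map there ∘ φ-sound
      glue : ∀ {x y} → φ x ≡ φ y ⊎ (φ x ≡ φ (s e) × φ y ≡ φ (t e) ⊎ φ x ≡ φ (t e) × φ y ≡ φ (s e)) →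
             Conn (_∈ e ∷ L) x y
      glue (inj₁ eq) = φ-conn eq
      glue (inj₂ (inj₁ (xs , yt))) = φ-conn xs ◅◅ across (here refl) ◅◅ φ-conn (sym yt)
      glue (inj₂ (inj₂ (xt , ys))) = φ-conn xt ◅◅ conn-sym (across (here refl)) ◅◅ φ-conn (sym ys)
      smaller : suc q < n ⊎ Injective _≡_ _≡_ φ → suc q ≤ n
      smaller (inj₁ lt) = ≤-trans (n≤1+n _) lt
      -- `σ` has the left inverse `φ`, so it embeds the `suc q` classes in the `n` vertices.
      smaller (inj₂ _) = injective⇒≤ λ {c} {d} eq → trans (sym (φσ c)) (trans (cong φ eq) (φσ d))

  module _ (P? : Decidable P) where

    edges : List (Fin m)
    edges = filter P? (allFin m)

    ∈-edges : ∀ {e} → P e → e ∈ edges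
    ∈-edges = ∈-filter⁺ P? (∈-allFin _)

    edges-∈ : ∀ {e} → e ∈ edges → P e
    edges-∈ = proj₂ ∘ ∈-filter⁻ P? {xs = allFin m}

    edge-components : Components edges
    edge-components = components edges (filter⁺ P? (allFin⁺ m))

    open Components edge-components

    conn⇒same-comp : Conn P x y → comp x ≡ comp y
    conn⇒same-comp ε = refl
    conn⇒same-comp ((e , p , inj₁ (refl , refl)) ◅ c) = trans (complete (∈-edges p)) (conn⇒same-comp c)
    conn⇒same-comp ((e , p , inj₂ (refl , refl)) ◅ c) = trans (sym (complete (∈-edges p))) (conn⇒same-comp c)

    conn? : ∀ x y → Dec (Conn P x y)
    conn? x y = map′ (conn-map edges-∈ ∘ sound) conn⇒same-comp (comp x ≟ comp y)

  -- A cut is a Boolean function on the vertices, so cuts of a contraction pull back by composition.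
  -- Loops never cross.
  EdgeConnected : ℕ → Set
  EdgeConnected d = ∀ (S : Fin n → Bool) x y → S x ≢ S y →
    d ≤ sum (λ e → ind (¬? (S (s e) Bool.≟ S (t e))))

  -- Extremal colourings and free edges.

  module _ {k : ℕ} where

    Colouring : Set
    Colouring = Fin m → Fin k

    private variable
      c c′ : Colouring
      e : Fin m

    _[_≔_] : Colouring → Fin m → Fin k → Colouring
    (c [ e ≔ i ]) f = if does (f ≟ e) then i else c f

    recolour-at : ∀ c e i → (c [ e ≔ i ]) e ≡ i
    recolour-at c e i with e ≟ e
    ... | yes _ = refl
    ... | no e≢e = contradiction refl e≢e

    recolour-off : ∀ c e i {f} → f ≢ e → (c [ e ≔ i ]) f ≡ c f
    recolour-off c e i {f} f≢e with f ≟ e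
    ... | yes f≡e = contradiction f≡e f≢e
    ... | no _ = refl

    -- The edge is a loop or lies on a cycle of its own colour.
    Redundant : Colouring → Fin m → Set
    Redundant c e = Conn (λ f → f ≢ e × c f ≡ c e) (s e) (t e)

    data Orbit (c : Colouring) : Colouring → Set where
      start : Orbit c c
      move  : ∀ {c′ e} → Orbit c c′ → Redundant c′ e → ∀ i → Orbit c (c′ [ e ≔ i ])

    -- Extremality in local form: throughout the orbit, recolouring a redundant edge never joins two
    -- components of the new colour.
    Maximal : Colouring → Set
    Maximal c = ∀ {c′ e} → Orbit c c′ → Redundant c′ e → ∀ i →
      Conn (λ g → g ≢ e × c′ g ≡ i) (s e) (t e)

    -- The recoloured edge can be bypassed within its old colour, so moves lose no connection.
    recolour-conn : ∀ {i j} → Redundant c e → Conn (λ f → c f ≡ j) x y → Conn (λ f → (c [ e ≔ i ]) f ≡ j) x y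
    recolour-conn {c = c} {e = e} {i = i} red = replace edge
      where
      edge : ∀ {f j} → c f ≡ j → Conn (λ f → (c [ e ≔ i ]) f ≡ j) (s f) (t f)
      edge {f} eq with f ≟ e
      ... | no f≢e = across (trans (recolour-off c e i f≢e) eq)
      ... | yes refl = conn-map (λ (g≢e , eq′) → trans (recolour-off c e i g≢e) (trans eq′ eq)) red

    orbit-conn : ∀ {j} → Orbit c c′ → Conn (λ f → c f ≡ j) x y → Conn (λ f → c′ f ≡ j) x y
    orbit-conn start p = p
    orbit-conn (move orb red i) p = recolour-conn red (orbit-conn orb p)

    defects : Colouring → Fin k → Fin n → Fin n → ℕ
    defects c i x y = ind (¬? (conn? (λ e → c e ≟ i) x y))

    -- A stand-in for the number of components: disconnected ordered pairs, summed over the colours,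
    -- can be compared term by term.
    deficiency : Colouring → ℕ
    deficiency c = sum λ i → sum λ x → sum λ y → defects c i x y

    -- Old connections survive by `orbit-conn`, and the ends of `e` become joined in colour `i`,
    -- which lowers one summand.
    augment : Orbit c c′ → Redundant c′ e → ∀ i → ¬ Conn (λ g → g ≢ e × c′ g ≡ i) (s e) (t e) →
              deficiency (c′ [ e ≔ i ]) < deficiency c
    augment {c = c} {c′} {e} orb red i ¬conn =
      sum-strict (λ j → sum-mono λ x → sum-mono λ y → mono j x y) i
        (sum-strict (λ x → sum-mono λ y → mono i x y) (s e)
          (sum-strict (λ y → mono i (s e) y) (t e) strict))
      where
      c″ = c′ [ e ≔ i ]
      mono : ∀ j x y → defects c″ j x y ≤ defects c j x y
      mono j x y = ind-mono (λ ¬p p → ¬p (orbit-conn (move orb red i) p))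
        (¬? (conn? (λ f → c″ f ≟ j) x y)) (¬? (conn? (λ f → c f ≟ j) x y))
      ¬conn-c : ¬ Conn (λ f → c f ≡ i) (s e) (t e)
      ¬conn-c p with c′ e ≟ i
      -- If `e` already has colour `i`, its redundancy is the excluded connection.
      ... | yes refl = ¬conn red
      ... | no c′e≢i = ¬conn (conn-map (λ eq → (λ { refl → c′e≢i eq }) , eq) (orbit-conn orb p))
      strict : defects c″ i (s e) (t e) < defects c i (s e) (t e)
      strict = ind-strict (λ ¬p → ¬p (across (recolour-at c′ e i))) ¬conn-c
        (¬? (conn? (λ f → c″ f ≟ i) (s e) (t e))) (¬? (conn? (λ f → c f ≟ i) (s e) (t e)))

    -- Descent on `deficiency`: a connection missing in the orbit yields a smaller value. Maximality
    -- concerns a whole orbit and is not decided, hence the double negation.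
    maximal-exists : Colouring → ¬ ¬ ∃ Maximal
    maximal-exists c none = <-rec (λ d → ∀ c → deficiency c ≡ d → ⊥) improve (deficiency c) c refl
      where
      improve : ∀ d → (∀ {d′} → d′ < d → ∀ c → deficiency c ≡ d′ → ⊥) → ∀ c → deficiency c ≡ d → ⊥
      improve _ rec c refl = none (c , λ {c′} {e} orb red i →
        check orb red i (conn? (λ g → ¬? (g ≟ e) ×-dec c′ g ≟ i) (s e) (t e)))
        where
        check : Orbit c c′ → Redundant c′ e → ∀ i → Dec (Conn (λ g → g ≢ e × c′ g ≡ i) (s e) (t e)) →
                Conn (λ g → g ≢ e × c′ g ≡ i) (s e) (t e)
        check orb red i (yes p) = p
        check orb red i (no ¬p) = ⊥-elim (rec (augment orb red i ¬p) _ refl)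

    Free : Colouring → Fin m → Set
    Free c e = ∃ λ c′ → Orbit c c′ × Redundant c′ e

    -- Once e has colour i, every edge of an i-coloured path between its ends
    -- lies on a cycle through e, hence is redundant.
    redundant-conn : Maximal c → Orbit c c′ → Redundant c′ e → ∀ i →
                     Conn (λ g → c′ g ≡ i × Free c g) (s e) (t e)
    redundant-conn {c} {c′} {e} max orb red i = conn-map free (bypass (max orb red i))
      where
      c″ = c′ [ e ≔ i ]
      free : ∀ {f} → (f ≢ e × c′ f ≡ i) × Bypassed (λ g → g ≢ e × c′ g ≡ i) (s e) (t e) f →
             c′ f ≡ i × Free c f
      free {f} ((f≢e , c′f≡i) , u , w , j , p , q) = c′f≡i , c″ , move orb red i ,
        against j (conn-sym (conn-map detour p)
                   ◅◅ across (f≢e ∘ sym , trans (recolour-at c′ e i) (sym c″f≡i))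
                   ◅◅ conn-sym (conn-map detour q))
        where
        c″f≡i : c″ f ≡ i
        c″f≡i = trans (recolour-off c′ e i f≢e) c′f≡i
        detour : ∀ {g} → (g ≢ e × c′ g ≡ i) × g ≢ f → g ≢ f × c″ g ≡ c″ f
        detour ((g≢e , eq) , g≢f) = g≢f , trans (recolour-off c′ e i g≢e) (trans eq (sym c″f≡i))

    -- Moves are undone from the last to the first. Where the path uses the recoloured edge,
    -- `redundant-conn` supplies a free path of colour `i` in the colouring before the move.
    orbit-free-conn : Maximal c → Orbit c c′ → ∀ {i} →
      Conn (λ g → c′ g ≡ i × Free c g) x y → Conn (λ g → c g ≡ i × Free c g) x y
    orbit-free-conn max start p = p
    orbit-free-conn {c} max (move {c′} {e} orb red j) {i} p = orbit-free-conn max orb (replace edge p)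
      where
      edge : ∀ {g} → (c′ [ e ≔ j ]) g ≡ i × Free c g → Conn (λ g → c′ g ≡ i × Free c g) (s g) (t g)
      edge {g} (eq , free) with g ≟ e
      ... | no g≢e = across (eq , free)
      ... | yes refl = redundant-conn max orb red i

    -- This is what permits contraction: each component of the free edges is connected in every
    -- colour by free edges.
    free-conn : Maximal c → Free c e → ∀ i → Conn (λ g → c g ≡ i × Free c g) (s e) (t e)
    free-conn max (c′ , orb , red) i = orbit-free-conn max orb (redundant-conn max orb red i)

  -- The forest bound for a colour class.

  module _ {k : ℕ} (c : Fin m → Fin k) where

    proper? : ∀ i e → Dec (c e ≡ i × s e ≢ t e)
    proper? i e = c e ≟ i ×-dec ¬? (s e ≟ t e)

    -- Without redundant non-loops, the non-loops of one colour form a forest. The vertex `x`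
    -- guarantees at least one component, which makes the bound strict.
    few-proper : ¬ (∃ λ e → s e ≢ t e × Redundant c e) → Fin n → ∀ i → sum (λ e → ind (proper? i e)) < n
    few-proper none x i = subst (_< n) (length-filter-tabulate (proper? i) id)
      (bound (comp x) forest)
      where
      open Components (edge-components (proper? i))
      bound : ∀ {q} → Fin q → length (edges (proper? i)) + q ≤ n ⊎ (∃ λ e → e ∈ edges (proper? i) ×
                Conn (λ g → g ∈ edges (proper? i) × g ≢ e) (s e) (t e)) → length (edges (proper? i)) < n
      bound {suc q} _ (inj₁ le) = ≤-trans (≤-trans (s≤s (m≤m+n _ q)) (≤-reflexive (sym (+-suc _ q)))) le
      bound _ (inj₂ (e , e∈ , p)) = ⊥-elim (none (e , proj₂ e-proper , conn-map
        (λ (g∈ , g≢e) → g≢e , trans (proj₁ (edges-∈ (proper? i) g∈)) (sym (proj₁ e-proper))) p))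
        where e-proper = edges-∈ (proper? i) e∈

-- Tree packing

module Redundancy {m n′ k′ : ℕ} (s t : Fin m → Fin (2 + n′)) (c : Fin m → Fin (suc k′)) where
  open Multigraph s t

  -- The boundary of `v` alone; its sum over the edges is the degree of `v`, loops excluded.
  star-cross : Fin (2 + n′) → Fin m → ℕ
  star-cross v e = ind (¬? (does (v ≟ s e) Bool.≟ does (v ≟ t e)))

  proper : Fin m → ℕ
  proper e = ind (¬? (s e ≟ t e))

  star-cross-≤ : ∀ e → sum (λ v → star-cross v e) ≤ proper e + proper e
  star-cross-≤ e with s e ≟ t e
  ... | yes eq = ≤-trans
    (sum-≤ λ v → ≤-reflexive (ind-no (λ ne → ne (cong (λ z → does (v ≟ z)) eq))
                                     (¬? (does (v ≟ s e) Bool.≟ does (v ≟ t e)))))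
    (≤-reflexive (*-comm (2 + n′) 0))
  ... | no _ = begin
    sum (λ v → star-cross v e)                            ≤⟨ sum-mono bound ⟩
    sum (λ v → ind (v ≟ s e) + ind (v ≟ t e))             ≡⟨ ∑-distrib-+ (λ v → ind (v ≟ s e)) (λ v → ind (v ≟ t e)) ⟩
    sum (λ v → ind (v ≟ s e)) + sum (λ v → ind (v ≟ t e)) ≤⟨ +-mono-≤ (sum-ind-≟ (s e)) (sum-ind-≟ (t e)) ⟩
    2 ∎
    where
    open ≤-Reasoning
    bound : ∀ v → star-cross v e ≤ ind (v ≟ s e) + ind (v ≟ t e)
    bound v with does (v ≟ s e) | does (v ≟ t e)
    ... | true  | true  = z≤n
    ... | true  | false = ≤-refl
    ... | false | true  = ≤-refl
    ... | false | false = z≤n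

  proper-≤ : ∀ e → proper e ≤ sum (λ i → ind (proper? c i e))
  proper-≤ e = ≤-trans (ind-mono (refl ,_) (¬? (s e ≟ t e)) (proper? c (c e) e))
    (term≤sum (λ i → ind (proper? c i e)) (c e))

  degree-bound : ∀ {d} → EdgeConnected d → ∀ v → d ≤ sum (star-cross v)
  degree-bound conn v = conn (λ x → does (v ≟ x)) v (punchIn v zero) differ
    where
    differ : does (v ≟ v) ≢ does (v ≟ punchIn v zero)
    differ eq with v ≟ v | v ≟ punchIn v zero
    ... | no v≢v | _      = v≢v refl
    ... | yes _  | yes v≡ = punchInᵢ≢i v zero (sym v≡)
    differ () | yes _ | no _

  -- Double counting. With N vertices and K colours, the degrees give at least KN non-loops, while K
  -- forests have at most K(N - 1) edges.
  redundant-exists : EdgeConnected (2 * suc k′) → ¬ ¬ (∃ λ e → s e ≢ t e × Redundant c e)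
  redundant-exists conn none = ≤⇒≯ total (*-monoʳ-< (2 * suc k′) (n<1+n (suc n′)))
    where
    open ≤-Reasoning
    #proper-≤ : sum proper ≤ suc k′ * suc n′
    #proper-≤ = begin
      sum proper                                  ≤⟨ sum-mono proper-≤ ⟩
      sum (λ e → sum λ i → ind (proper? c i e))   ≡⟨ ∑-comm (λ e i → ind (proper? c i e)) ⟩
      sum (λ i → sum λ e → ind (proper? c i e))   ≤⟨ sum-≤ (λ i → s≤s⁻¹ (few-proper c none zero i)) ⟩
      suc k′ * suc n′ ∎
    total : 2 * suc k′ * (2 + n′) ≤ 2 * suc k′ * suc n′
    total = begin
      2 * suc k′ * (2 + n′)                       ≡⟨ *-comm (2 * suc k′) (2 + n′) ⟩
      (2 + n′) * (2 * suc k′)                     ≤⟨ sum-≥ (degree-bound conn) ⟩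
      sum (λ v → sum λ e → star-cross v e)        ≡⟨ ∑-comm star-cross ⟩
      sum (λ e → sum λ v → star-cross v e)        ≤⟨ sum-mono star-cross-≤ ⟩
      sum (λ e → proper e + proper e)             ≡⟨ ∑-distrib-+ proper proper ⟩
      sum proper + sum proper                     ≤⟨ +-mono-≤ #proper-≤ #proper-≤ ⟩
      suc k′ * suc n′ + suc k′ * suc n′           ≡⟨ cong (suc k′ * suc n′ +_) (sym (+-identityʳ _)) ⟩
      2 * (suc k′ * suc n′)                       ≡⟨ *-assoc 2 (suc k′) (suc n′) ⟨
      2 * suc k′ * suc n′ ∎

Packing : ∀ {m n} (s t : Fin m → Fin n) (k : ℕ) → Set
Packing {m} s t k = ∃ λ (c : Fin m → Fin k) → ∀ i x y → Multigraph.Conn s t (λ e → c e ≡ i) x y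

-- Induction on the number of vertices. The components of the free edges are contracted, and a free
-- non-loop makes the quotient smaller. A packing of the quotient colours the other edges; free
-- edges keep their colour in `c`.
tree-packing-¬¬ : ∀ {m k} n (s t : Fin m → Fin n) →
  Multigraph.EdgeConnected s t (2 * suc k) → ¬ ¬ Packing s t (suc k)
tree-packing-¬¬ {m} {k} = <-rec _ pack
  where
  pack : ∀ n → (∀ {n′} → n′ < n → ∀ (s t : Fin m → Fin n′) →
                  Multigraph.EdgeConnected s t (2 * suc k) → ¬ ¬ Packing s t (suc k)) →
         ∀ (s t : Fin m → Fin n) → Multigraph.EdgeConnected s t (2 * suc k) → ¬ ¬ Packing s t (suc k)
  pack zero    _ s t _ none = none (const zero , λ _ ())
  pack (suc zero) _ s t _ none = none (const zero , λ { _ zero zero → ε })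
  pack n@(suc (suc _)) rec s t conn none =
    maximal-exists (const zero) λ (c , max) →
    Redundancy.redundant-exists s t c conn λ (e₀ , proper , red) →
    ¬¬-decide-all (Free c) λ free? →
    contract c max free? e₀ proper (c , start , red)
    where
    open Multigraph s t
    contract : ∀ c → Maximal c → Decidable (Free c) → ∀ e₀ → s e₀ ≢ t e₀ → Free c e₀ → ⊥
    contract c max free? e₀ proper e₀-free =
      rec (smaller fewer) (comp ∘ s) (comp ∘ t) quotient-conn λ (c₁ , conn₁) → none (lift c₁ conn₁)
      where
      open Components (edge-components free?)
      smaller : #comp < n ⊎ (∀ {x y} → comp x ≡ comp y → x ≡ y) → #comp < n
      smaller (inj₁ lt)  = lt
      smaller (inj₂ inj) = ⊥-elim (proper (inj (complete (∈-edges free? e₀-free))))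
      quotient-conn : Multigraph.EdgeConnected (comp ∘ s) (comp ∘ t) (2 * suc k)
      -- A cut of the quotient and its pullback `S ∘ comp` have the same crossing edges; `rep`
      -- provides vertices on both sides.
      quotient-conn S a b Sa≢Sb = conn (S ∘ comp) (rep a) (rep b)
        λ eq → Sa≢Sb (trans (sym (cong S (comp-rep a))) (trans eq (cong S (comp-rep b))))
      lift : (c₁ : Fin m → Fin (suc k)) → (∀ i a b → Multigraph.Conn (comp ∘ s) (comp ∘ t) (λ e → c₁ e ≡ i) a b) →
             Packing s t (suc k)
      lift c₁ conn₁ = c₂ , λ i x y → unfold (conn₁ i (comp x) (comp y)) refl refl
        where
        c₂ : Fin m → Fin (suc k)
        c₂ e = if does (free? e) then c e else c₁ e
        c₂-free : ∀ {e} → Free c e → c₂ e ≡ c e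
        c₂-free {e} free with free? e
        ... | yes _ = refl
        ... | no ¬free = contradiction free ¬free
        inside : ∀ {i x y} → comp x ≡ comp y → Conn (λ e → c₂ e ≡ i) x y
        inside {i} eq = replace (λ e∈ → conn-map (λ (eq , free) → trans (c₂-free free) eq)
          (free-conn max (edges-∈ free? e∈) i)) (sound eq)
        hop : ∀ {i e} → c₁ e ≡ i → Conn (λ e → c₂ e ≡ i) (s e) (t e)
        hop {i} {e} eq with free? e in eqf
        -- A free edge is a loop in the quotient, so its ends lie in one contracted component and
        -- are joined there in every colour.
        ... | yes free = inside (complete (∈-edges free? free))
        ... | no ¬free = across (trans (cong (λ b → if does b then c e else c₁ e) eqf) eq)
        unfold : ∀ {i a b x y} → Multigraph.Conn (comp ∘ s) (comp ∘ t) (λ e → c₁ e ≡ i) a b →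
                 comp x ≡ a → comp y ≡ b → Conn (λ e → c₂ e ≡ i) x y
        unfold ε refl eq = inside (sym eq)
        unfold ((e , eq , inj₁ (p , q)) ◅ path) refl eq′ = inside (sym p) ◅◅ hop eq ◅◅ unfold path q eq′
        unfold ((e , eq , inj₂ (p , q)) ◅ path) refl eq′ = inside (sym q) ◅◅ conn-sym (hop eq) ◅◅ unfold path p eq′

-- Colourings are finite in number and connectivity is decidable, so exhaustive search removes the
-- double negation.
tree-packing : ∀ {m n k} (s t : Fin m → Fin n) → Multigraph.EdgeConnected s t (2 * suc k) → Packing s t (suc k)
tree-packing {m} {n} {k} s t conn 
  with any-vec? m (λ v → all? λ i → all? λ x → all? λ y → Multigraph.conn? s t (λ e → Vec.lookup v e ≟ i) x y)
... | yes (v , packing) = Vec.lookup v , packing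
... | no none = ⊥-elim (tree-packing-¬¬ n s t conn λ (c , packing) → none (Vec.tabulate c ,
    λ i x y → Multigraph.conn-map s t (λ {e} eq → trans (lookup∘tabulate c e) eq) (packing i x y)))

-- Trees given by a parent function

module ParentTree {X : Set} (_≟ˣ_ : DecidableEquality X) (root : X) (π : X → X) (D : X → ℕ)
                  (descends : ∀ x → x ≢ root → D (π x) < D x) where

  Up : X → X → Set
  Up x y = x ≢ root × π x ≡ y

  TreeRel : X → X → Set
  TreeRel x y = Up x y ⊎ Up y x

  up-< : ∀ {x y} → Up x y → D y < D x
  up-< (x≢ , refl) = descends _ x≢

  to-root : ∀ x → Star TreeRel x root
  to-root x = <-rec (λ d → ∀ x → D x ≡ d → Star TreeRel x root) climb-up (D x) x refl
    where
    climb-up : ∀ d → (∀ {d′} → d′ < d → ∀ x → D x ≡ d′ → Star TreeRel x root) → ∀ x → D x ≡ d → Star TreeRel x root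
    climb-up _ rec x refl with x ≟ˣ root
    ... | yes refl = ε
    ... | no x≢    = inj₁ (x≢ , refl) ◅ rec (descends x x≢) (π x) refl

  connected : ConnectedRel TreeRel
  connected x y = star⇒walk (to-root x ◅◅ reverse swap (to-root y))

  last∈ : ∀ {u v vs} → Walk TreeRel u v vs → v ∈ vs
  last∈ (nil _)    = here refl
  last∈ (cons _ w) = there (last∈ w)

  -- A simple path that has started to descend can only go on descending.
  descent : ∀ {u w v vs} → Up w u → Walk TreeRel w v vs → Unique (u ∷ vs) →
            D u < D v × (v ≡ w ⊎ π v ∈ vs)
  descent up (nil _) _ = up-< up , inj₁ refl
  descent (_ , refl) (cons (inj₁ (_ , refl)) walk) ((_ ∷ u∉) ∷ _) = ⊥-elim (All¬⇒¬Any u∉ (head∈ walk))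
  descent up (cons (inj₂ up′) walk) (_ ∷ distinct) with descent up′ walk distinct
  ... | lt , inj₁ refl = <-trans (up-< up) lt , inj₂ (here (proj₂ up′))
  ... | lt , inj₂ πv∈  = <-trans (up-< up) lt , inj₂ (there πv∈)

  -- A simple path climbs first and then descends; if it descends at all, it reaches `v` from the
  -- parent of `v`.
  climb : ∀ {u v vs} → Walk TreeRel u v vs → Unique vs → D v ≤ D u ⊎ π v ∈ vs
  climb (nil _) _ = inj₁ ≤-refl
  climb (cons (inj₁ up) walk) (_ ∷ distinct) with climb walk distinct
  ... | inj₁ le  = inj₁ (≤-trans le (<⇒≤ (up-< up)))
  ... | inj₂ πv∈ = inj₂ (there πv∈)
  climb (cons (inj₂ up) walk) distinct with descent up walk distinct
  ... | _ , inj₁ refl = inj₂ (here (proj₂ up))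
  ... | _ , inj₂ πv∈  = inj₂ (there πv∈)

  closed-simple : ∀ {u vs} → Walk TreeRel u u vs → Unique vs → ¬ 2 ≤ length vs
  closed-simple (nil _) _ (s≤s ())
  closed-simple (cons _ walk) (u∉ ∷ _) _ = All¬⇒¬Any u∉ (last∈ walk)

  -- The cases are the directions of the first step and of the closing edge; each gives a repeated
  -- vertex or a circular inequality for `D`.
  acyclic : ¬ Cycle TreeRel
  acyclic (u , v , _ , nil _ , _ , s≤s () , _)
  acyclic (u , v , _ , cons (inj₂ up) walk , distinct@(u∉ ∷ distinct′) , s≤s long , back)
    with descent up walk distinct | back
  ... | lt , _         | inj₂ up′        = <-asym lt (up-< up′)
  ... | _  , inj₁ refl | _               = closed-simple walk distinct′ long
  ... | _  , inj₂ πv∈  | inj₁ (_ , refl) = All¬⇒¬Any u∉ πv∈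
  acyclic (u , v , _ , cons (inj₁ (_ , refl)) walk , u∉ ∷ distinct , s≤s long , inj₂ (_ , refl)) =
    closed-simple walk distinct long
  acyclic (u , v , _ , cons (inj₁ up) walk , u∉ ∷ distinct , s≤s long , inj₁ up′)
    with climb walk distinct
  ... | inj₁ le  = <-irrefl refl (<-trans (≤-<-trans le (up-< up)) (up-< up′))
  ... | inj₂ πv∈ = All¬⇒¬Any u∉ (subst (_∈ _) (proj₂ up′) πv∈)

  -- An inner vertex has two distinct neighbours on the path but one parent, so one neighbour is a
  -- child.
  inner-after : ∀ {u w v x vs} → TreeRel u w → Walk TreeRel w v vs → Unique (u ∷ vs) →
                x ∈ vs → x ≢ v → ∃ λ y → Up y x
  inner-after r (nil _) _ (here refl) x≢v = ⊥-elim (x≢v refl)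
  inner-after (inj₁ up) (cons _ _) _ (here refl) _ = _ , up
  inner-after (inj₂ _) (cons (inj₂ up) _) _ (here refl) _ = _ , up
  inner-after (inj₂ (_ , refl)) (cons (inj₁ (_ , refl)) walk) ((_ ∷ u∉) ∷ _) (here refl) _ =
    ⊥-elim (All¬⇒¬Any u∉ (head∈ walk))
  inner-after _ (cons r walk) (_ ∷ distinct) (there x∈) x≢v = inner-after r walk distinct x∈ x≢v

  inner-has-child : ∀ {u v x vs} → SimplePath TreeRel u v vs → x ∈ vs → x ≢ u → x ≢ v → ∃ λ y → Up y x
  inner-has-child (nil _ , _)              (here refl) x≢u _   = ⊥-elim (x≢u refl)
  inner-has-child (cons _ _ , _)           (here refl) x≢u _   = ⊥-elim (x≢u refl)
  inner-has-child (cons r walk , distinct) (there x∈)  _   x≢v = inner-after r walk distinct x∈ x≢v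

consec-step : ∀ {V : Set} {R : V → V → Set} {u v vs a b} → Walk R u v vs → Consec a b vs → R a b
consec-step (cons r (nil _))    here      = r
consec-step (cons r (cons _ _)) here      = r
consec-step (cons _ walk)       (there p) = consec-step walk p
consec-step (nil _)             (there ())

-- Breadth-first trees

module BreadthFirst {n : ℕ} {R : Fin n → Fin n → Set} (R? : ∀ x y → Dec (R x y)) (r : Fin n)
                    (reach : ∀ x → Star R x r) where

  -- Being cumulative in `d`, it lets `least` count down and stop at the first failure.
  Within : ℕ → Fin n → Set
  Within zero    x = x ≡ r
  Within (suc d) x = Within d x ⊎ ∃ λ y → R x y × Within d y

  within? : ∀ d x → Dec (Within d x)
  within? zero    x = x ≟ r
  within? (suc d) x = within? d x ⊎-dec any? λ y → R? x y ×-dec within? d y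

  within-mono : ∀ {d d′ x} → d ≤ d′ → Within d x → Within d′ x
  within-mono {d′ = zero}  z≤n w = w
  within-mono {d′ = suc _} z≤n w = inj₁ (within-mono z≤n w)
  within-mono (s≤s le) (inj₁ w)           = inj₁ (within-mono le w)
  within-mono (s≤s le) (inj₂ (y , e , w)) = inj₂ (y , e , within-mono le w)

  within : ∀ {x} → Star R x r → ∃ λ d → Within d x
  within ε       = 0 , refl
  within (e ◅ p) with d , w ← within p = suc d , inj₂ (_ , e , w)

  Least : Fin n → ℕ → Set
  Least x d = Within d x × (∀ d′ → Within d′ x → d ≤ d′)

  least : ∀ d {x} → Within d x → ∃ (Least x)
  least zero    w = 0 , w , λ _ _ → z≤n
  least (suc d) {x} w with within? d x
  ... | yes w′ = least d w′
  ... | no ¬w′ = suc d , w , λ d′ w′ → ≰⇒> λ d′≤d → ¬w′ (within-mono d′≤d w′)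

  distance : ∀ x → ∃ (Least x)
  distance x = least _ (proj₂ (within (reach x)))

  depth : Fin n → ℕ
  depth x = proj₁ (distance x)

  closer : ∀ {x d} → x ≢ r → Least x d → ∃ λ y → R x y × depth y < d
  closer {d = zero}  x≢r (x≡r , _) = ⊥-elim (x≢r x≡r)
  closer {d = suc d} x≢r (inj₁ w , min) = ⊥-elim (<-irrefl refl (min d w))
  closer {d = suc d} x≢r (inj₂ (y , e , w) , min) = y , e , s≤s (proj₂ (proj₂ (distance y)) d w)

  parent-of : ∀ x → ∃ λ y → x ≢ r → R x y × depth y < depth x
  parent-of x with x ≟ r
  -- The root gets itself as a default; the guard `x ≢ r` keeps it out of the claim.
  ... | yes x≡r = r , λ x≢r → ⊥-elim (x≢r x≡r)
  ... | no x≢r with y , p ← closer x≢r (proj₂ (distance x)) = y , λ _ → p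

-- Edges as vertices of the line graph

module LineEdges {n : ℕ} (G : FinGraph n) where

  E : Set
  E = Edge G

  private variable
    e f : E
    x y z : Fin n

  ends-injective : proj₁ e ≡ proj₁ f → e ≡ f
  ends-injective {_ , lt , a} {_ , lt′ , a′} refl = cong₂ (λ l a → _ , l , a) (<-irrelevant lt lt′) (Bool.T-irrelevant a a′)

  _≟ᴱ_ : DecidableEquality E
  e ≟ᴱ f = map′ ends-injective (cong proj₁) (Product.≡-dec _≟_ _≟_ (proj₁ e) (proj₁ f))

  Ends : E → Fin n → Fin n → Set
  Ends e x y = proj₁ e ≡ (x , y) ⊎ proj₁ e ≡ (y , x)

  Inc : E → Fin n → Set
  Inc e x = proj₁ (proj₁ e) ≡ x ⊎ proj₂ (proj₁ e) ≡ x

  inc₁ : ∀ e → Ends e x y → Inc e x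
  inc₁ _ (inj₁ refl) = inj₁ refl
  inc₁ _ (inj₂ refl) = inj₂ refl

  inc₂ : ∀ e → Ends e x y → Inc e y
  inc₂ e = inc₁ e ∘ swap

  -- Edges are stored as increasing pairs, so the two opposite readings cannot both occur.
  ends-determined : Ends e x y → Ends f x y → e ≡ f
  ends-determined (inj₁ p) (inj₁ q) = ends-injective (trans p (sym q))
  ends-determined (inj₂ p) (inj₂ q) = ends-injective (trans p (sym q))
  ends-determined {_ , lt , _} {f = _ , lt′ , _} (inj₁ refl) (inj₂ refl) = ⊥-elim (<-asym lt lt′)
  ends-determined {_ , lt , _} {f = _ , lt′ , _} (inj₂ refl) (inj₁ refl) = ⊥-elim (<-asym lt lt′)

  ends-unique : ∀ e {x′ y′} → Ends e x y → Ends e x′ y′ → x ≡ x′ ⊎ (x ≡ y′ × x′ ≡ y)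
  ends-unique _ (inj₁ refl) (inj₁ refl) = inj₁ refl
  ends-unique _ (inj₁ refl) (inj₂ refl) = inj₂ (refl , refl)
  ends-unique _ (inj₂ refl) (inj₁ refl) = inj₂ (refl , refl)
  ends-unique _ (inj₂ refl) (inj₂ refl) = inj₁ refl

  inc-adj : e ≢ f → Inc e z → Inc f z → Adj (LineGraph G) e f
  inc-adj e≢f p q = e≢f ∘ ends-injective , share p q
    where
    share : ∀ {a b c d z : Fin n} → a ≡ z ⊎ b ≡ z → c ≡ z ⊎ d ≡ z → (a ≡ c ⊎ a ≡ d) ⊎ (b ≡ c ⊎ b ≡ d)
    share (inj₁ p) (inj₁ q) = inj₁ (inj₁ (trans p (sym q)))
    share (inj₁ p) (inj₂ q) = inj₁ (inj₂ (trans p (sym q)))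
    share (inj₂ p) (inj₁ q) = inj₂ (inj₁ (trans p (sym q)))
    share (inj₂ p) (inj₂ q) = inj₂ (inj₂ (trans p (sym q)))

  avoid-vertex : ∀ r e → ∃ λ x → x ≢ r × Inc e x
  avoid-vertex r ((a , b) , a<b , _) with a ≟ r
  ... | no a≢r = a , a≢r , inj₁ refl
  ... | yes refl = b , (λ { refl → <-irrefl refl a<b }) , inj₂ refl

-- Trees of the line graph from rooted trees of `G`.

module LineTrees {n : ℕ} (G : FinGraph n) (r v₀ : Fin n) (v₀≢r : v₀ ≢ r) {k : ℕ}
  (parent : Fin k → Fin n → Fin n) (depth : Fin k → Fin n → ℕ)
  (parent-edge : Fin k → Fin n → Edge G) (colour : Edge G → Fin k)
  (parent-edge-ends : ∀ i {v} → v ≢ r → LineEdges.Ends G (parent-edge i v) v (parent i v))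
  (parent-edge-colour : ∀ i {v} → v ≢ r → colour (parent-edge i v) ≡ i)
  (descends : ∀ i {v} → v ≢ r → depth i (parent i v) < depth i v) where

  open LineEdges G

  TreeEdge : Fin k → E → Set
  TreeEdge i e = ∃ λ v → v ≢ r × parent-edge i v ≡ e

  tree-edge? : ∀ i e → Dec (TreeEdge i e)
  tree-edge? i e = any? λ v → ¬? (v ≟ r) ×-dec parent-edge i v ≟ᴱ e

  tree-edge-colour : ∀ {i e} → TreeEdge i e → colour e ≡ i
  tree-edge-colour (v , v≢r , refl) = parent-edge-colour _ v≢r

  -- One edge above two different vertices would make each the parent of the other, against
  -- `descends`.
  parent-edge-injective : ∀ i {v w} → v ≢ r → w ≢ r → parent-edge i v ≡ parent-edge i w → v ≡ w
  parent-edge-injective i v≢r w≢r eq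
    with ends-unique (parent-edge i _) (parent-edge-ends i v≢r)
           (subst (λ e → Ends e _ _) (sym eq) (parent-edge-ends i w≢r))
  ... | inj₁ v≡w = v≡w
  ... | inj₂ (v≡pw , w≡pv) = ⊥-elim (<-asym
    (subst (λ z → depth i z < depth i _) (sym v≡pw) (descends i w≢r))
    (subst (λ z → depth i z < depth i _) (sym w≡pv) (descends i v≢r)))

  parent≢ : ∀ i {v} → v ≢ r → parent i v ≢ v
  parent≢ i v≢r eq = <-irrefl (cong (depth i) eq) (descends i v≢r)

  -- The end at which `e` is hung. The second alternative keeps it away from `r`, above which there
  -- is no edge; for edges in no tree the condition is vacuous.
  Anchored : E → Fin n → Set
  Anchored e a = ∀ i {v} → v ≢ r → parent-edge i v ≡ e →
    (parent i v ≢ r × a ≡ parent i v) ⊎ (parent i v ≡ r × a ≡ v)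

  -- An edge can lie only in the tree of its own colour, so one test suffices. An edge in no tree
  -- takes any end other than `r`.
  choose-anchor : ∀ e → ∃ λ a → a ≢ r × Inc e a × Anchored e a
  choose-anchor e with tree-edge? (colour e) e
  ... | no ¬tree with a , a≢r , inc ← avoid-vertex r e =
    a , a≢r , inc , λ i v≢r eq → ⊥-elim (¬tree (_ , v≢r ,
      trans (cong (λ j → parent-edge j _) (colour-eq i v≢r eq)) eq))
    where
    colour-eq : ∀ i {v} → v ≢ r → parent-edge i v ≡ e → colour e ≡ i
    colour-eq i v≢r eq = tree-edge-colour (_ , v≢r , eq)
  ... | yes (v , v≢r , eq) with parent (colour e) v ≟ r
  ...   | yes p≡r = v , v≢r , subst (λ f → Inc f v) eq (inc₁ (parent-edge _ _) (parent-edge-ends _ v≢r)) , anchored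
    where
    anchored : Anchored e v
    anchored i w≢r eq′ with tree-edge-colour (_ , w≢r , eq′)
    ... | refl with parent-edge-injective i v≢r w≢r (trans eq (sym eq′))
    ...   | refl = inj₂ (p≡r , refl)
  ...   | no p≢r = parent _ v , p≢r ,
    subst (λ f → Inc f (parent _ v)) eq (inc₂ (parent-edge _ _) (parent-edge-ends _ v≢r)) , anchored
    where
    anchored : Anchored e (parent _ v)
    anchored i w≢r eq′ with tree-edge-colour (_ , w≢r , eq′)
    ... | refl with parent-edge-injective i v≢r w≢r (trans eq (sym eq′))
    ...   | refl = inj₁ (p≢r , refl)

  anchor : E → Fin n
  anchor e = proj₁ (choose-anchor e)

  anchor≢r : ∀ e → anchor e ≢ r
  anchor≢r e = proj₁ (proj₂ (choose-anchor e))

  anchor-inc : ∀ e → Inc e (anchor e)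
  anchor-inc e = proj₁ (proj₂ (proj₂ (choose-anchor e)))

  anchored : ∀ e → Anchored e (anchor e)
  anchored e = proj₂ (proj₂ (proj₂ (choose-anchor e)))

  root-child : ∀ i → ∃ λ v → v ≢ r × parent i v ≡ r
  root-child i = <-rec (λ d → ∀ v → v ≢ r → depth i v ≡ d → ∃ λ v → v ≢ r × parent i v ≡ r) up _ v₀ v₀≢r refl
    where
    up : ∀ d → (∀ {d′} → d′ < d → ∀ v → v ≢ r → depth i v ≡ d′ → ∃ λ v → v ≢ r × parent i v ≡ r) →
         ∀ v → v ≢ r → depth i v ≡ d → ∃ λ v → v ≢ r × parent i v ≡ r
    up _ rec v v≢r refl with parent i v ≟ r
    ... | yes p≡r = v , v≢r , p≡r
    ... | no p≢r  = rec (descends i v≢r) (parent i v) p≢r refl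

  root-edge : Fin k → E
  root-edge i = parent-edge i (proj₁ (root-child i))

  root-edge-inc : ∀ i → Inc (root-edge i) r
  root-edge-inc i with w , w≢r , p≡r ← root-child i =
    subst (Inc (parent-edge i w)) p≡r (inc₂ (parent-edge _ _) (parent-edge-ends i w≢r))

  root-edge-tree : ∀ i → TreeEdge i (root-edge i)
  root-edge-tree i with w , w≢r , _ ← root-child i = w , w≢r , refl

  -- The edge above the anchor of `e` is `e` itself exactly when `e` is a tree edge at `r`; such
  -- edges hang on `root-edge i`, which also ends at `r`.
  up-edge : Fin k → E → E
  up-edge i e with parent-edge i (anchor e) ≟ᴱ e
  ... | yes _ = root-edge i
  ... | no _  = parent-edge i (anchor e)

  -- The value 0 puts the root edge strictly below the other tree edges at `r`; the `suc` puts the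
  -- remaining edges above the tree edge on which they hang.
  height : Fin k → E → ℕ
  height i e with e ≟ᴱ root-edge i | tree-edge? i e
  ... | yes _ | _           = 0
  ... | no _  | yes (v , _) = depth i v
  ... | no _  | no _        = suc (depth i (anchor e))

  height-root : ∀ i → height i (root-edge i) ≡ 0
  height-root i with root-edge i ≟ᴱ root-edge i
  ... | yes _ = refl
  ... | no ne = ⊥-elim (ne refl)

  height-parent-edge : ∀ i {v} → v ≢ r → height i (parent-edge i v) ≤ depth i v
  height-parent-edge i {v} v≢r with parent-edge i v ≟ᴱ root-edge i | tree-edge? i (parent-edge i v)
  ... | yes _ | _ = z≤n
  ... | no _ | no ¬tree = ⊥-elim (¬tree (v , v≢r , refl))
  ... | no _ | yes (w , w≢r , eq) with refl ← parent-edge-injective i w≢r v≢r eq = ≤-refl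

  height-positive : ∀ i e → e ≢ root-edge i → 0 < height i e
  height-positive i e ne with e ≟ᴱ root-edge i | tree-edge? i e
  ... | yes eq | _ = ⊥-elim (ne eq)
  ... | no _ | yes (v , v≢r , _) = ≤-<-trans z≤n (descends i v≢r)
  ... | no _ | no _ = s≤s z≤n

  height-anchor : ∀ i e → e ≢ root-edge i → parent-edge i (anchor e) ≢ e → depth i (anchor e) < height i e
  height-anchor i e ne ne′ with e ≟ᴱ root-edge i | tree-edge? i e
  ... | yes eq | _ = ⊥-elim (ne eq)
  ... | no _ | no _ = ≤-refl
  ... | no _ | yes (v , v≢r , eq) with anchored e i v≢r eq
  ...   | inj₁ (_ , a≡p) = subst (λ a → depth i a < depth i v) (sym a≡p) (descends i v≢r)
  ...   | inj₂ (_ , a≡v) = ⊥-elim (ne′ (trans (cong (parent-edge i) a≡v) eq))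

  up-edge-descends : ∀ i e → e ≢ root-edge i → height i (up-edge i e) < height i e
  up-edge-descends i e ne with parent-edge i (anchor e) ≟ᴱ e
  ... | yes _ = subst (_< height i e) (sym (height-root i)) (height-positive i e ne)
  ... | no ne′ = ≤-<-trans (height-parent-edge i (anchor≢r e)) (height-anchor i e ne ne′)

  module Tree (i : Fin k) = ParentTree _≟ᴱ_ (root-edge i) (up-edge i) (height i) (up-edge-descends i)

  up-adj : ∀ i {e f} → Tree.Up i e f → Adj (LineGraph G) e f
  up-adj i {e} (ne , refl) with parent-edge i (anchor e) ≟ᴱ e
  ... | no ne′ = inc-adj (ne′ ∘ sym) (anchor-inc e) (inc₁ (parent-edge _ _) (parent-edge-ends i (anchor≢r e)))
  ... | yes eq with anchored e i (anchor≢r e) eq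
  ...   | inj₁ (_ , a≡p) = ⊥-elim (parent≢ i (anchor≢r e) (sym a≡p))
  ...   | inj₂ (p≡r , _) = inc-adj ne
    (subst (λ f → Inc f r) eq (subst (Inc (parent-edge i (anchor e))) p≡r
      (inc₂ (parent-edge _ _) (parent-edge-ends i (anchor≢r e)))))
    (root-edge-inc i)

  spanning : ∀ i → IsSpanningTree (LineGraph G) (Tree.TreeRel i)
  spanning i = record
    { sub       = λ {e} {f} → [ up-adj i , Adj-sym (LineGraph G) {f} {e} ∘ up-adj i ]′
    ; symmetric = swap
    ; connected = Tree.connected i
    ; acyclic   = Tree.acyclic i
    }

  up-tree-edge : ∀ i {e f} → Tree.Up i e f → TreeEdge i f
  up-tree-edge i {e} (_ , refl) with parent-edge i (anchor e) ≟ᴱ e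
  ... | yes _ = root-edge-tree i
  ... | no _  = anchor e , anchor≢r e , refl

  -- In the exceptional case of `up-edge`, `e` would be a tree edge of colour `i`.
  up-foreign : ∀ i {e f} → colour e ≢ i → Tree.Up i e f → parent-edge i (anchor e) ≡ f
  up-foreign i {e} ne (_ , refl) with parent-edge i (anchor e) ≟ᴱ e
  ... | yes eq = ⊥-elim (ne (tree-edge-colour (_ , anchor≢r e , eq)))
  ... | no _   = refl

  -- Each edge would be the tree edge above the anchor of the other. If both anchors are upper ends,
  -- or both are lower ends below `r`, then `e` and `f` have the same ends although their colours
  -- differ. In the mixed cases a vertex is its own parent.
  up-antisym : ∀ {i j} → i ≢ j → ∀ {e f} → Tree.Up i e f → Tree.Up j f e → ⊥
  up-antisym {i} {j} i≢j {e} {f} up up′ = conflict (anchored e j (anchor≢r f) e-eq) (anchored f i (anchor≢r e) f-eq)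
    where
    e-colour : colour e ≡ j
    e-colour = tree-edge-colour (up-tree-edge j up′)
    f-colour : colour f ≡ i
    f-colour = tree-edge-colour (up-tree-edge i up)
    f-eq : parent-edge i (anchor e) ≡ f
    f-eq = up-foreign i (λ eq → i≢j (trans (sym eq) e-colour)) up
    e-eq : parent-edge j (anchor f) ≡ e
    e-eq = up-foreign j (λ eq → i≢j (trans (sym f-colour) eq)) up′
    e≢f : e ≢ f
    e≢f refl = i≢j (trans (sym f-colour) e-colour)
    e-ends : Ends e (anchor f) (parent j (anchor f))
    e-ends = subst (λ z → Ends z _ _) e-eq (parent-edge-ends j (anchor≢r f))
    f-ends : Ends f (anchor e) (parent i (anchor e))
    f-ends = subst (λ z → Ends z _ _) f-eq (parent-edge-ends i (anchor≢r e))
    conflict : (parent j (anchor f) ≢ r × anchor e ≡ parent j (anchor f)) ⊎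
               (parent j (anchor f) ≡ r × anchor e ≡ anchor f) →
               (parent i (anchor e) ≢ r × anchor f ≡ parent i (anchor e)) ⊎
               (parent i (anchor e) ≡ r × anchor f ≡ anchor e) → ⊥
    conflict (inj₁ (_ , p)) (inj₁ (_ , q)) = e≢f (ends-determined {e} {f = f}
      (subst (Ends e (anchor f)) (sym p) e-ends) (swap (subst (Ends f (anchor e)) (sym q) f-ends)))
    conflict (inj₁ (_ , p)) (inj₂ (_ , q)) = parent≢ j (anchor≢r f) (sym (trans q p))
    conflict (inj₂ (_ , p)) (inj₁ (_ , q)) = parent≢ i (anchor≢r e) (sym (trans p q))
    conflict (inj₂ (p , eq)) (inj₂ (q , _)) = e≢f (ends-determined {e} {f = f}
      (subst (Ends e (anchor f)) p e-ends) (subst₂ (Ends f) eq q f-ends))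

  trees-disjoint : ∀ {i j} → i ≢ j → ∀ {e f} → Tree.TreeRel i e f → Tree.TreeRel j e f → ⊥
  trees-disjoint {i} {j} i≢j (inj₁ up) (inj₁ up′) =
    i≢j (trans (sym (tree-edge-colour (up-tree-edge i up))) (tree-edge-colour (up-tree-edge j up′)))
  trees-disjoint {i} {j} i≢j (inj₂ up) (inj₂ up′) =
    i≢j (trans (sym (tree-edge-colour (up-tree-edge i up))) (tree-edge-colour (up-tree-edge j up′)))
  trees-disjoint i≢j (inj₁ up) (inj₂ up′) = up-antisym i≢j up up′
  trees-disjoint i≢j (inj₂ up) (inj₁ up′) = up-antisym i≢j up up′

  edge-step : ∀ i {u v P a b} → SimplePath (Tree.TreeRel i) u v P → EdgeOn a b P → Tree.TreeRel i a b
  edge-step i (walk , _) = [ consec-step walk , swap ∘ consec-step walk ]′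

  -- An inner vertex has a child, hence is a tree edge; a vertex inner to paths in two trees would
  -- have two colours.
  inner-colour : ∀ i {u v P x} → SimplePath (Tree.TreeRel i) u v P → x ∈ P → x ≢ u → x ≢ v → colour x ≡ i
  inner-colour i path x∈ x≢u x≢v = tree-edge-colour (up-tree-edge i (proj₂ (Tree.inner-has-child i path x∈ x≢u x≢v)))

  cists : HasCISTs (LineGraph G) k
  cists = Tree.TreeRel , spanning , λ i j i≢j u v _ P Q p q →
    (λ a b on-p on-q → trees-disjoint i≢j (edge-step i p on-p) (edge-step j q on-q)) ,
    λ x x∈P x∈Q → at-end i≢j p q x∈P x∈Q (x ≟ᴱ u) (x ≟ᴱ v)
    where
    at-end : ∀ {i j u v P Q x} → i ≢ j → SimplePath (Tree.TreeRel i) u v P → SimplePath (Tree.TreeRel j) u v Q →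
             x ∈ P → x ∈ Q → Dec (x ≡ u) → Dec (x ≡ v) → x ≡ u ⊎ x ≡ v
    at-end _ _ _ _ _ (yes x≡u) _ = inj₁ x≡u
    at-end _ _ _ _ _ (no _) (yes x≡v) = inj₂ x≡v
    at-end {i} {j} i≢j p q x∈P x∈Q (no x≢u) (no x≢v) = ⊥-elim
      (i≢j (trans (sym (inner-colour i p x∈P x≢u x≢v)) (inner-colour j q x∈Q x≢u x≢v)))

-- Edge cuts of G and the line graph

module Cuts {n : ℕ} (G : FinGraph n) where
  open LineEdges G

  IsEdge : Fin n × Fin n → Set
  IsEdge p = proj₁ p Fin.< proj₂ p × T (adj G (proj₁ p) (proj₂ p))

  _∈ᶠ?_ : ∀ p (F : List (Fin n × Fin n)) → Dec (p ∈ F)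
  _∈ᶠ?_ = ∈-dec (Product.≡-dec _≟_ _≟_)

  delete-sym : ∀ {F x y} → DeleteEdges G F x y → DeleteEdges G F y x
  delete-sym (a , p , q) = Adj-sym (toGraph G) a , q , p

  Kept : List (Fin n × Fin n) → Fin n → Set
  Kept F v = ∃ (DeleteEdges G F v)

  kept? : ∀ F v → Dec (Kept F v)
  kept? F v = any? λ w → T? (adj G v w) ×-dec (¬? ((v , w) ∈ᶠ? F) ×-dec ¬? ((w , v) ∈ᶠ? F))

  kept-edge : ∀ {F v} → Kept F v → ∃ λ e → proj₁ e ∉ F × Inc e v
  kept-edge {v = v} (w , a , vw∉ , wv∉) with <-cmp v w
  ... | tri< v<w _ _    = ((v , w) , v<w , a) , vw∉ , inj₁ refl
  ... | tri≈ _ refl _   = ⊥-elim (Adj-irrefl (toGraph G) {v} a)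
  ... | tri> _ _ w<v    = ((w , v) , w<v , Adj-sym (toGraph G) {v} {w} a) , wv∉ , inj₂ refl

  unkept-isolates : ∀ {F v} → ¬ Kept F v → IsolatesVertex G F
  unkept-isolates {F} {v} ¬kept = v , λ w a → cut w a ((v , w) ∈ᶠ? F) ((w , v) ∈ᶠ? F)
    where
    cut : ∀ w → T (adj G v w) → Dec ((v , w) ∈ F) → Dec ((w , v) ∈ F) → (v , w) ∈ F ⊎ (w , v) ∈ F
    cut w a (yes p) _       = inj₁ p
    cut w a (no _)  (yes q) = inj₂ q
    cut w a (no p)  (no q)  = ⊥-elim (¬kept (w , a , p , q))

  edge-list : ∀ {F} → All IsEdge F → List E
  edge-list []             = []
  edge-list (_∷_ {p} e es) = (p , e) ∷ edge-list es

  length-edge-list : ∀ {F} (es : All IsEdge F) → length (edge-list es) ≡ length F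
  length-edge-list []       = refl
  length-edge-list (_ ∷ es) = cong suc (length-edge-list es)

  edge-list-sound : ∀ {F e} (es : All IsEdge F) → e ∈ edge-list es → proj₁ e ∈ F
  edge-list-sound (_ ∷ es) (here refl) = here refl
  edge-list-sound (_ ∷ es) (there e∈)  = there (edge-list-sound es e∈)

  edge-list-complete : ∀ {F} (es : All IsEdge F) e → proj₁ e ∈ F → e ∈ edge-list es
  edge-list-complete (_ ∷ es) e (here eq) = here (ends-injective eq)
  edge-list-complete (_ ∷ es) e (there p) = there (edge-list-complete es e p)

  across-edge : ∀ {F} → All IsEdge F → ∀ e → proj₁ e ∉ F → ∀ {x y} → Inc e x → Inc e y → Star (DeleteEdges G F) x y
  across-edge {F} es ((a , b) , a<b , adj) ab∉ = go
    where
    step : DeleteEdges G F a b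
    step = adj , ab∉ , λ ba∈ → <-asym a<b (proj₁ (All.lookup es ba∈))
    go : ∀ {x y} → a ≡ x ⊎ b ≡ x → a ≡ y ⊎ b ≡ y → Star (DeleteEdges G F) x y
    go (inj₁ refl) (inj₁ refl) = ε
    go (inj₁ refl) (inj₂ refl) = step ◅ ε
    go (inj₂ refl) (inj₁ refl) = delete-sym {F} step ◅ ε
    go (inj₂ refl) (inj₂ refl) = ε

  shared-end : ∀ {e f} → Adj (LineGraph G) e f → ∃ λ z → Inc e z × Inc f z
  shared-end (_ , inj₁ (inj₁ eq)) = _ , inj₁ refl , inj₁ (sym eq)
  shared-end (_ , inj₁ (inj₂ eq)) = _ , inj₁ refl , inj₂ (sym eq)
  shared-end (_ , inj₂ (inj₁ eq)) = _ , inj₂ refl , inj₁ (sym eq)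
  shared-end (_ , inj₂ (inj₂ eq)) = _ , inj₂ refl , inj₂ (sym eq)

  line-walk : ∀ {F} (es : All IsEdge F) {e f x y vs} → Walk (Adj (LineGraph G)) e f vs → All (_∉ edge-list es) vs →
              Inc e x → Inc f y → Star (DeleteEdges G F) x y
  line-walk es {e} (nil _) (e∉ ∷ _) ex fy = across-edge es e (e∉ ∘ edge-list-complete es e) ex fy
  line-walk es {e} (cons {w = g} a walk) (e∉ ∷ vs∉) ex fy with z , ez , gz ← shared-end {e} {g} a =
    across-edge es e (e∉ ∘ edge-list-complete es e) ex ez ◅◅ line-walk es walk vs∉ gz fy

  -- Surviving edges at `u` and `v` are vertices of the line graph, and removing fewer than `d`
  -- others leaves them joined by surviving edges.
  kept-connected : ∀ {d F} → KConnected (LineGraph G) d → IsEdgeSet G F → length F < d →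
                   (∀ v → Kept F v) → ConnectedRel (DeleteEdges G F)
  kept-connected {F = F} (_ , conn) (_ , es) short kept u v
    with e , e∉ , eu ← kept-edge {F} (kept u) | f , f∉ , fv ← kept-edge {F} (kept v)
    with _ , walk , avoids ← conn (edge-list es) (subst (_< _) (sym (length-edge-list es)) short)
           e f (e∉ ∘ edge-list-sound es) (f∉ ∘ edge-list-sound es)
    = star⇒walk (line-walk es walk avoids eu fv)

  -- The double negation matches `IsEdgeCut`, which asserts a negated connectivity.
  CutsAtLeast : ℕ → Set
  CutsAtLeast d = ∀ F → IsEdgeSet G F → length F < d → ¬ ¬ ConnectedRel (DeleteEdges G F)

  -- A cut with fewer than `d` edges makes every minimum cut that small. By `kept-connected` each of
  -- these isolates a vertex, so `G` would be super edge-connected.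
  ¬super⇒cuts : ∀ {d} → ConnectedRel (Adj (toGraph G)) → KConnected (LineGraph G) d →
                ¬ SuperEdgeConnected G → CutsAtLeast d
  ¬super⇒cuts connG conn ¬super F₀ set₀ short cut₀ = ¬super (connG , isolates)
    where
    isolates : ∀ F → IsMinEdgeCut G F → IsolatesVertex G F
    isolates F ((set , cut) , min) with all? (kept? F)
    ... | yes kept = ⊥-elim (cut (kept-connected conn set (≤-<-trans (min F₀ (set₀ , cut₀)) short) kept))
    ... | no ¬kept = unkept-isolates {F} (proj₂ (¬∀⟶∃¬ n (Kept F) (kept? F) ¬kept))

  -- Every neighbour of `v` is the other end of an edge in `F`, and neighbours are distinct.
  isolated-degree : ∀ {F v} → ¬ Kept F v → degree G v ≤ length F
  isolated-degree {F} {v} ¬kept = ≤-trans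
    (unique-⊆-length (filter⁺ (λ w → T? (adj G v w)) (allFin⁺ n)) covered) (≤-reflexive (length-map other F))
    where
    other : Fin n × Fin n → Fin n
    other (a , b) = if does (a ≟ v) then b else a
    other-ˡ : ∀ w → other (v , w) ≡ w
    other-ˡ w with v ≟ v
    ... | yes _ = refl
    ... | no v≢v = ⊥-elim (v≢v refl)
    other-ʳ : ∀ w → other (w , v) ≡ w
    other-ʳ w with w ≟ v
    ... | yes eq = sym eq
    ... | no _ = refl
    covered : ∀ {w} → w ∈ filter (λ w → T? (adj G v w)) (allFin n) → w ∈ map other F
    covered {w} w∈ with proj₂ (∈-filter⁻ (λ w → T? (adj G v w)) {xs = allFin n} w∈) | (v , w) ∈ᶠ? F | (w , v) ∈ᶠ? F
    ... | _ | yes p | _     = subst (_∈ map other F) (other-ˡ w) (∈-map⁺ other p)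
    ... | _ | no _  | yes q = subst (_∈ map other F) (other-ʳ w) (∈-map⁺ other q)
    ... | a | no p  | no q  = ⊥-elim (¬kept (w , a , p , q))

  minDegree⇒cuts : ∀ {d} → KConnected (LineGraph G) d → MinDegreeAtLeast G d → CutsAtLeast d
  minDegree⇒cuts conn deg F set short cut = cut (kept-connected conn set short kept)
    where
    kept : ∀ v → Kept F v
    kept v with kept? F v
    ... | yes p = p
    ... | no ¬p = ⊥-elim (<⇒≱ short (≤-trans (deg v) (isolated-degree {F} ¬p)))

  -- The graph as a multigraph, and its packing turned into trees.

  isEdge? : ∀ p → Dec (IsEdge p)
  isEdge? p = proj₁ p Fin.<? proj₂ p ×-dec T? (adj G (proj₁ p) (proj₂ p))

  pair : Fin (n * n) → Fin n × Fin n
  pair = remQuot {n} n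

  -- G is encoded as a multigraph with an edge for each pair of vertices; the
  -- pairs that are not (increasingly ordered) edges of G become loops.
  head-or-loop : ∀ p → Dec (IsEdge p) → Fin n
  head-or-loop p (yes _) = proj₂ p
  head-or-loop p (no _)  = proj₁ p

  src tgt : Fin (n * n) → Fin n
  src e = proj₁ (pair e)
  tgt e = head-or-loop (pair e) (isEdge? (pair e))

  open Multigraph src tgt

  proper-edge : ∀ e → src e ≢ tgt e → IsEdge (pair e) × pair e ≡ (src e , tgt e)
  proper-edge e = proper (isEdge? (pair e))
    where
    proper : ∀ {p} (edge? : Dec (IsEdge p)) → proj₁ p ≢ head-or-loop p edge? →
             IsEdge p × p ≡ (proj₁ p , head-or-loop p edge?)
    proper (yes edge) _  = edge , refl
    proper (no _)     ne = ⊥-elim (ne refl)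

  tgt-edge : ∀ e → IsEdge (pair e) → tgt e ≡ proj₂ (pair e)
  tgt-edge e edge with isEdge? (pair e)
  ... | yes _ = refl
  ... | no ¬edge = ⊥-elim (¬edge edge)

  pair-injective : ∀ {e f} → pair e ≡ pair f → e ≡ f
  pair-injective {e} {f} eq = trans (sym (combine-remQuot {n} n e))
    (trans (cong (uncurry combine) eq) (combine-remQuot {n} n f))

  -- The pairs crossing `S` form an edge set of `G`. After its deletion `S` is constant along walks,
  -- so `x` and `y` are separated.
  cuts⇒edgeConnected : ∀ {d} → CutsAtLeast d → EdgeConnected d
  cuts⇒edgeConnected {d} cuts S x y Sx≢Sy with d ≤? sum (λ e → ind (¬? (S (src e) Bool.≟ S (tgt e))))
  ... | yes le = le
  ... | no ¬le = ⊥-elim (cuts F (map⁺ pair-injective (filter⁺ cross? (allFin⁺ (n * n))) , All.tabulate F-edges)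
      (subst (_< d) (sym length-F) (≰⇒> ¬le)) λ conn → Sx≢Sy (constant (proj₂ (conn x y))))
    where
    cross? : ∀ e → Dec (S (src e) ≢ S (tgt e))
    cross? e = ¬? (S (src e) Bool.≟ S (tgt e))
    F : List (Fin n × Fin n)
    F = map pair (filter cross? (allFin (n * n)))
    length-F : length F ≡ sum (λ e → ind (cross? e))
    length-F = trans (length-map pair (filter cross? (allFin (n * n)))) (length-filter-tabulate cross? id)
    F-edges : ∀ {p} → p ∈ F → IsEdge p
    F-edges p∈ with e , e∈ , refl ← ∈-map⁻ pair p∈ =
      proj₁ (proper-edge e λ eq → proj₂ (∈-filter⁻ cross? {xs = allFin (n * n)} e∈) (cong S eq))
    F-complete : ∀ {u v} → IsEdge (u , v) → S u ≢ S v → (u , v) ∈ F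
    F-complete {u} {v} edge Su≢Sv = subst (_∈ F) uv (∈-map⁺ pair (∈-filter⁺ cross? (∈-allFin (combine u v))
      λ eq → Su≢Sv (trans (cong (S ∘ proj₁) (sym uv)) (trans eq (cong S
        (trans (tgt-edge (combine u v) (subst IsEdge (sym uv) edge)) (cong proj₂ uv)))))))
      where
      uv : pair (combine u v) ≡ (u , v)
      uv = remQuot-combine u v
    same-side : ∀ {u v} → DeleteEdges G F u v → S u ≡ S v
    same-side {u} {v} (a , uv∉ , vu∉) with S u Bool.≟ S v
    ... | yes eq = eq
    ... | no ne with <-cmp u v
    ...   | tri< u<v _ _  = ⊥-elim (uv∉ (F-complete (u<v , a) ne))
    ...   | tri≈ _ refl _ = refl
    ...   | tri> _ _ v<u  = ⊥-elim (vu∉ (F-complete (v<u , Adj-sym (toGraph G) {u} {v} a) (ne ∘ sym)))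
    constant : ∀ {u v vs} → Walk (DeleteEdges G F) u v vs → S u ≡ S v
    constant (nil _)    = refl
    constant (cons d w) = trans (same-side d) (constant w)

  -- Each colour class gets a breadth-first tree rooted at the same end `r` of `e₀`; the other end
  -- serves as `v₀`.
  packing⇒cists : ∀ {k} → E → Packing src tgt k → HasCISTs (LineGraph G) k
  packing⇒cists {k} e₀ (c , conn) = LineTrees.cists G r v₀ v₀≢r parent (λ i → BF.depth i)
    (λ i v → proj₁ (edge-above i v)) colour
    (λ i {v} v≢r → proj₁ (proj₂ (edge-above i v) v≢r)) (λ i {v} v≢r → proj₂ (proj₂ (edge-above i v) v≢r))
    (λ i {v} v≢r → proj₂ (proj₂ (BF.parent-of i v) v≢r))
    where
    r v₀ : Fin n
    r = proj₁ (proj₁ e₀)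
    v₀ = proj₁ (avoid-vertex r e₀)
    v₀≢r : v₀ ≢ r
    v₀≢r = proj₁ (proj₂ (avoid-vertex r e₀))
    colour : E → Fin k
    colour e = c (uncurry combine (proj₁ e))
    link-dec : ∀ i x y → Dec (Link (λ e → c e ≡ i) x y)
    link-dec i x y = any? λ e → c e ≟ i ×-dec ((src e ≟ x ×-dec tgt e ≟ y) ⊎-dec (src e ≟ y ×-dec tgt e ≟ x))
    module BF (i : Fin k) = BreadthFirst (link-dec i) r (λ x → conn i x r)
    parent : Fin k → Fin n → Fin n
    parent i v = proj₁ (BF.parent-of i v)
    link-edge : ∀ {i x y} → x ≢ y → Link (λ e → c e ≡ i) x y → ∃ λ e → Ends e x y × colour e ≡ i
    link-edge {i} x≢y (e , eq , j) = (pair e , proj₁ proper) , joined j ,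
      trans (cong c (combine-remQuot {n} n e)) eq
      where
      src≢tgt : src e ≢ tgt e
      src≢tgt eq′ = x≢y ([ (λ { (refl , refl) → eq′ }) , (λ { (refl , refl) → sym eq′ }) ]′ j)
      proper : IsEdge (pair e) × pair e ≡ (src e , tgt e)
      proper = proper-edge e src≢tgt
      joined : ∀ {x y} → Joins e x y → pair e ≡ (x , y) ⊎ pair e ≡ (y , x)
      joined (inj₁ (refl , refl)) = inj₁ (proj₂ proper)
      joined (inj₂ (refl , refl)) = inj₂ (proj₂ proper)
    edge-above : ∀ i v → ∃ λ e → v ≢ r → Ends e v (parent i v) × colour e ≡ i
    edge-above i v = choose (v ≟ r)
      where
      choose : Dec (v ≡ r) → ∃ λ e → v ≢ r → Ends e v (parent i v) × colour e ≡ i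
      -- A default value, as no edge lies above the root.
      choose (yes v≡r) = e₀ , λ v≢r → ⊥-elim (v≢r v≡r)
      choose (no v≢r) = proj₁ found , λ _ → proj₂ found
        where
        above : Link (λ e → c e ≡ i) v (parent i v) × BF.depth i (parent i v) < BF.depth i v
        above = proj₂ (BF.parent-of i v) v≢r
        found : ∃ λ e → Ends e v (parent i v) × colour e ≡ i
        found = link-edge (λ eq → <-irrefl (cong (BF.depth i) (sym eq)) (proj₂ above)) (proj₁ above)

theorem4 : ∀ (k : ℕ) → 2 ≤ k → ∀ {n : ℕ} (G : FinGraph n) →
    ConnectedRel (Adj (toGraph G)) →
    KConnected (LineGraph G) (2 * k) →
    (¬ SuperEdgeConnected G ⊎ MinDegreeAtLeast G (2 * k)) →
    HasCISTs (LineGraph G) k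
-- The list of distinct vertices in `KConnected` is nonempty and provides an edge `e₀` of `G`.
theorem4 (suc k) _ G connG conn@((e₀ ∷ _ , _) , _) hyp =
  packing⇒cists e₀ (tree-packing src tgt (cuts⇒edgeConnected
    ([ ¬super⇒cuts connG conn , minDegree⇒cuts conn ]′ hyp)))
  where open Cuts G
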